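{- Let $(T,\mu,\eta)$ be an ordered saturation monad on $\mathsf{Set}$ such that arbitrary cotupling in $\mathcal{K}l(T)$ is monotonic and $T$ weakly lax preserves pullbacks, and assume the category of $T$-coalgebras has a final object $\zeta:Z\to TZ$. For a coalgebra $\beta:Y\to TY$ let $\mathsf{beh}_\beta:Y\to Z$ be the unique coalgebra homomorphism to $\zeta$. Then for every $\alpha:X\to TX$ and $x,y\in X$: $x\approx_*y$ if and only if $\mathsf{beh}_{\zeta^*}(\mathsf{beh}_\alpha(x))=\mathsf{beh}_{\zeta^*}(\mathsf{beh}_\alpha(y))$, where $\approx_*$ is the greatest weak bisimulation on $\alpha$.
   Context: Kleisli category $\mathcal{K}l(T)$: morphisms $X\rightsquigarrow Y$ are maps $X\to TY$, composition $g\cdot f=\mu_Z\circ Tg\circ f$, identity $1_X=\eta_X$; $f^\sharp=\eta_Y\circ f$. A homomorphism of $T$-coalgebras $\alpha\to\beta$ is a map $h$ with $Th\circ\alpha=\beta\circ h$. Ordered saturation monad: $\mathcal{K}l(T)$ order enriched and for each $\alpha:X\rightsquigarrow X$ there is $\alpha^*$ with (1) $1\le\alpha^*$; (2) $\alpha\le\alpha^*$; (3) $\alpha^*\cdot\alpha^*\le\alpha^*$; (4) $\alpha^*\le\beta$ whenever $1\le\beta$, $\alpha\le\beta$, $\beta\cdot\beta\le\beta$; (5) for any map $f:X\to Y$ and $\beta:Y\rightsquigarrow Y$, $f^\sharp\cdot\alpha\le\beta\cdot f^\sharp\Rightarrow f^\sharp\cdot\alpha^*\le\beta^*\cdot f^\sharp$,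 and likewise with $\ge$. Weak bisimulation on $\alpha$: symmetric $R\subseteq X\times X$ with some $\gamma:R\to TR$ such that $\alpha\cdot\pi_1^\sharp\le\pi_1^\sharp\cdot\gamma$ and $\pi_2^\sharp\cdot\gamma\le\alpha^*\cdot\pi_2^\sharp$. Cotupling monotonic: $f_i\le g_i$ for all $i$ implies $[\{f_i\}]\le[\{g_i\}]$ in $\mathcal{K}l(T)$. Weakly lax preserving pullbacks: for every pullback $P$ (projections $p_1,p_2$) of $A\xrightarrow{f}C\xleftarrow{g}B$, the $T$-image square is a weak pullback and for any $q_1:W\to TA$, $q_2:W\to TB$ with $Tf\circ q_1\le Tg\circ q_2$ there is $\xi:W\to TP$ with $q_1\le Tp_1\circ\xi$ and $Tp_2\circ\xi\le q_2$. -}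

module Defs where

open import Data.Product using (Σ; Σ-syntax; ∃; _×_; _,_; proj₁; proj₂)
open import Relation.Binary.PropositionalEquality using (_≡_)
open import Function using (_∘_; id)

-- Pointwise equality of functions (equality of morphisms in Set;
-- we have no function extensionality).
_≐_ : {A B : Set} → (A → B) → (A → B) → Set
f ≐ g = ∀ a → f a ≡ g a
infix 4 _≐_

record Monad : Set₁ where
  field
    T    : Set → Set
    fmap : {A B : Set} → (A → B) → T A → T B
    η    : {A : Set} → A → T A
    μ    : {A : Set} → T (T A) → T A
    fmap-cong : {A B : Set} {f g : A → B} → f ≐ g → fmap f ≐ fmap g
    fmap-id   : {A : Set} → fmap (id {A = A}) ≐ id
    fmap-∘    : {A B C : Set} (g : B → C) (f : A → B) →
                fmap (g ∘ f) ≐ fmap g ∘ fmap f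
    η-natural : {A B : Set} (f : A → B) → fmap f ∘ η ≐ η ∘ f
    μ-natural : {A B : Set} (f : A → B) → fmap f ∘ μ ≐ μ ∘ fmap (fmap f)
    μ-η       : {A : Set} → μ ∘ η {T A} ≐ id
    μ-Tη      : {A : Set} → μ ∘ fmap (η {A}) ≐ id
    μ-assoc   : {A : Set} → μ ∘ μ {T A} ≐ μ ∘ fmap (μ {A})

  _⇝_ : Set → Set → Set
  X ⇝ Y = X → T Y

  _·_ : {X Y Z : Set} → (Y ⇝ Z) → (X ⇝ Y) → (X ⇝ Z)
  g · f = μ ∘ fmap g ∘ f
  infixr 9 _·_

  𝟙 : {X : Set} → X ⇝ X
  𝟙 = η

  _♯ : {X Y : Set} → (X → Y) → X ⇝ Y
  f ♯ = η ∘ f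

  IsCoalgHom : {X Y : Set} → (X → T X) → (Y → T Y) → (X → Y) → Set
  IsCoalgHom α β h = fmap h ∘ α ≐ β ∘ h

record OrderedSaturationMonad : Set₁ where
  field
    monad : Monad
  open Monad monad public
  field
    _≤_      : {X Y : Set} → (X ⇝ Y) → (X ⇝ Y) → Set
    ≤-resp   : {X Y : Set} {f f' g g' : X ⇝ Y} →
               f ≐ f' → g ≐ g' → f ≤ g → f' ≤ g'
    ≤-refl   : {X Y : Set} {f : X ⇝ Y} → f ≤ f
    ≤-trans  : {X Y : Set} {f g h : X ⇝ Y} → f ≤ g → g ≤ h → f ≤ h
    ≤-antisym : {X Y : Set} {f g : X ⇝ Y} → f ≤ g → g ≤ f → f ≐ g
    ·-mono   : {X Y Z : Set} {f f' : X ⇝ Y} {g g' : Y ⇝ Z} →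
               f ≤ f' → g ≤ g' → (g · f) ≤ (g' · f')
    _* : {X : Set} → (X ⇝ X) → (X ⇝ X)
    sat-1 : {X : Set} (α : X ⇝ X) → 𝟙 ≤ (α *)
    sat-2 : {X : Set} (α : X ⇝ X) → α ≤ (α *)
    sat-3 : {X : Set} (α : X ⇝ X) → ((α *) · (α *)) ≤ (α *)
    sat-4 : {X : Set} (α β : X ⇝ X) →
            𝟙 ≤ β → α ≤ β → (β · β) ≤ β → (α *) ≤ β
    sat-5≤ : {X Y : Set} (f : X → Y) (α : X ⇝ X) (β : Y ⇝ Y) →
             ((f ♯) · α) ≤ (β · (f ♯)) → ((f ♯) · (α *)) ≤ ((β *) · (f ♯))
    sat-5≥ : {X Y : Set} (f : X → Y) (α : X ⇝ X) (β : Y ⇝ Y) →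
             (β · (f ♯)) ≤ ((f ♯) · α) → ((β *) · (f ♯)) ≤ ((f ♯) · (α *))
  infix 4 _≤_

module _ (S : OrderedSaturationMonad) where
  open OrderedSaturationMonad S

  -- arbitrary cotupling in Kl(T) is monotonic
  -- (coproduct of a family X : I → Set in Kl(T) is Σ I X, as in Set)
  cotuple : {I : Set} {X : I → Set} {Y : Set} →
            ((i : I) → X i ⇝ Y) → Σ I X ⇝ Y
  cotuple f (i , x) = f i x

  CotuplingMonotonic : Set₁
  CotuplingMonotonic = {I : Set} {X : I → Set} {Y : Set}
    (f g : (i : I) → X i ⇝ Y) → ((i : I) → f i ≤ g i) →
    cotuple f ≤ cotuple g

  Pullback : {A B C : Set} → (A → C) → (B → C) → Set
  Pullback {A} {B} f g = Σ (A × B) λ ab → f (proj₁ ab) ≡ g (proj₂ ab)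

  pb₁ : {A B C : Set} {f : A → C} {g : B → C} → Pullback f g → A
  pb₁ ((a , _) , _) = a

  pb₂ : {A B C : Set} {f : A → C} {g : B → C} → Pullback f g → B
  pb₂ ((_ , b) , _) = b

  WeaklyLaxPreservesPullbacks : Set₁
  WeaklyLaxPreservesPullbacks = {A B C : Set} (f : A → C) (g : B → C) →
    ((s : T A) (t : T B) → fmap f s ≡ fmap g t →
       Σ (T (Pullback f g)) λ p →
         (fmap pb₁ p ≡ s) × (fmap pb₂ p ≡ t))
    ×
    ({W : Set} (q₁ : W → T A) (q₂ : W → T B) →
       (fmap f ∘ q₁) ≤ (fmap g ∘ q₂) →
       Σ (W → T (Pullback f g)) λ ξ →
         (q₁ ≤ (fmap pb₁ ∘ ξ)) × ((fmap pb₂ ∘ ξ) ≤ q₂))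

  record FinalCoalgebra : Set₁ where
    field
      Z      : Set
      ζ      : Z → T Z
      beh    : {Y : Set} (β : Y → T Y) → Y → Z
      beh-hom : {Y : Set} (β : Y → T Y) → IsCoalgHom β ζ (beh β)
      beh-unique : {Y : Set} (β : Y → T Y) (h : Y → Z) →
                   IsCoalgHom β ζ h → h ≐ beh β

  record IsWeakBisimulation {X : Set} (α : X → T X) (R : X → X → Set) : Set where
    field
      symmetric : ∀ {x y} → R x y → R y x
      γ         : Σ (X × X) (λ p → R (proj₁ p) (proj₂ p)) →
                  T (Σ (X × X) (λ p → R (proj₁ p) (proj₂ p)))
      cond₁     : (α · ((proj₁ ∘ proj₁) ♯)) ≤ (((proj₁ ∘ proj₁) ♯) · γ)
      cond₂     : (((proj₂ ∘ proj₁) ♯) · γ) ≤ ((α *) · ((proj₂ ∘ proj₁) ♯))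

  -- x ≈* y : (x, y) lies in some weak bisimulation on α, i.e. in the
  -- greatest weak bisimulation (the union of all weak bisimulations)
  WeaklyBisimilar : {X : Set} (α : X → T X) → X → X → Set₁
  WeaklyBisimilar {X} α x y =
    Σ (X → X → Set) λ R → IsWeakBisimulation α R × R x y

{-# OPTIONS --safe #-}

-- Since beh_α is also a homomorphism α* → ζ*, the composite beh_{ζ*} ∘ beh_α is
-- beh_{α*}, so the claim is that weak bisimilarity is the kernel of beh_{α*}.
-- That this kernel is a weak bisimulation is lax preservation of pullbacks.
--
-- Conversely, if R is a weak bisimulation via γ, then by saturation γ* relates
-- α* to itself laxly.  Dividing X by R would turn this into an equality by
-- antisymmetry, but type theory has no quotients.  Instead, saturating the map
-- true ↦ false on Bool yields binary joins in every T X, and an inequality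
-- t ≤ u becomes the equation t ∨ u = u, to which strict weak pullbacks apply.
-- For x R y this gives, over the equivalence closure of R, exact couplings of
-- α* x with α* x ∨ α* y and of α* y with α* y ∨ α* x; composing them makes the
-- closure a strict bisimulation on α*.
module Submission where

open import Defs
open import Data.Bool using (Bool; true; false; if_then_else_)
open import Data.Product using (Σ; _×_; _,_; proj₁; proj₂)
open import Data.Sum using (_⊎_; inj₁; inj₂; [_,_])
open import Data.Unit using (⊤; tt)
open import Function using (_∘_; id; const)
open import Relation.Binary using (IsEquivalence)
open import Relation.Binary.Construct.Closure.ReflexiveTransitive using (Star; ε; _◅_; _◅◅_; return; reverse)
open import Relation.Binary.PropositionalEquality using (_≡_; refl; sym; trans; cong; cong₂)

Graph : {X : Set} → (X → X → Set) → Set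
Graph {X} Q = Σ (X × X) λ p → Q (proj₁ p) (proj₂ p)

src tgt : {X : Set} {Q : X → X → Set} → Graph Q → X
src = proj₁ ∘ proj₁
tgt = proj₂ ∘ proj₁

module KleisliProperties (M : Monad) where
  open Monad M

  ♯-post : {A B C : Set} (h : B → C) (f : A ⇝ B) → (h ♯) · f ≐ fmap h ∘ f
  ♯-post h f a = trans (cong μ (fmap-∘ η h (f a))) (μ-Tη (fmap h (f a)))

  ♯-pre : {A B C : Set} (g : B ⇝ C) (h : A → B) → g · (h ♯) ≐ g ∘ h
  ♯-pre g h a = trans (cong μ (η-natural g (h a))) (μ-η (g (h a)))

  fmap-fuse : {A B C : Set} (g : B → C) (f : A → B) (h : A → C) →
              g ∘ f ≐ h → fmap g ∘ fmap f ≐ fmap h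
  fmap-fuse g f h e a = trans (sym (fmap-∘ g f a)) (fmap-cong e a)

-- Saturation, homomorphisms and the order on elements.

module SaturationProperties (S : OrderedSaturationMonad) where
  open OrderedSaturationMonad S
  open KleisliProperties monad public

  ≐⇒≤ : {X Y : Set} {f g : X ⇝ Y} → f ≐ g → f ≤ g
  ≐⇒≤ e = ≤-resp (λ _ → refl) e ≤-refl

  fmap-mono : {X Y Z : Set} (h : Y → Z) {f g : X ⇝ Y} →
              f ≤ g → (fmap h ∘ f) ≤ (fmap h ∘ g)
  fmap-mono h {f} {g} le = ≤-resp (♯-post h f) (♯-post h g) (·-mono le ≤-refl)

  ∘-monoˡ : {X Y Z : Set} (h : X → Y) {f g : Y ⇝ Z} → f ≤ g → (f ∘ h) ≤ (g ∘ h)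
  ∘-monoˡ h {f} {g} le = ≤-resp (♯-pre f h) (♯-pre g h) (·-mono ≤-refl le)

  𝟙*≤𝟙 : {X : Set} → (𝟙 {X} *) ≤ 𝟙
  𝟙*≤𝟙 = sat-4 𝟙 𝟙 ≤-refl ≤-refl (≐⇒≤ λ x → μ-Tη (η x))

  **≤* : {X : Set} (α : X ⇝ X) → ((α *) *) ≤ (α *)
  **≤* α = sat-4 (α *) (α *) (sat-1 α) ≤-refl (sat-3 α)

  -- A homomorphism is an equation between Kleisli composites with `h ♯`; both halves of the last
  -- saturation axiom apply to it, and antisymmetry reunites them.
  *-preserves-hom : {X Y : Set} {α : X → T X} {β : Y → T Y} {h : X → Y} →
                    IsCoalgHom α β h → IsCoalgHom (α *) (β *) h
  *-preserves-hom {α = α} {β} {h} hom a =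
    trans (sym (♯-post h (α *) a))
      (trans (≤-antisym
               (sat-5≤ h α β (≐⇒≤ kleisli-hom))
               (sat-5≥ h α β (≐⇒≤ (sym ∘ kleisli-hom))) a)
             (♯-pre (β *) h a))
    where
    kleisli-hom : (h ♯) · α ≐ β · (h ♯)
    kleisli-hom x = trans (♯-post h α x) (trans (hom x) (sym (♯-pre β h x)))

  infix 4 _⊑_
  -- The order is given on Kleisli maps, so elements are compared as maps out of a point.
  _⊑_ : {X : Set} → T X → T X → Set
  s ⊑ t = const {B = ⊤} s ≤ const t

  ⊑-antisym : {X : Set} {s t : T X} → s ⊑ t → t ⊑ s → s ≡ t
  ⊑-antisym p q = ≤-antisym p q tt

  ≤⇒⊑ : {X Y : Set} {f g : X ⇝ Y} → f ≤ g → ∀ x → f x ⊑ g x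
  ≤⇒⊑ le x = ∘-monoˡ (const x) le

-- Binary joins in `T X`.

module Joins (S : OrderedSaturationMonad) (cotupling : CotuplingMonotonic S) where
  open OrderedSaturationMonad S
  open SaturationProperties S

  step : Bool ⇝ Bool
  step = const false ♯

  -- This is the join of `η true` and `η false`.
  both : T Bool
  both = (step *) true

  infixr 6 _∨_
  _∨_ : {X : Set} → T X → T X → T X
  s ∨ t = μ (fmap (if_then s else t) both)

  fmap-∨ : {X Y : Set} (h : X → Y) (s t : T X) → fmap h (s ∨ t) ≡ fmap h s ∨ fmap h t
  fmap-∨ h s t = trans (μ-natural h _) (cong μ (fmap-fuse _ _ _ distrib both))
    where
    distrib : fmap h ∘ (if_then s else t) ≐ (if_then fmap h s else fmap h t)
    distrib true  = refl
    distrib false = refl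

  private
    extend-both : {X : Set} (k : Bool ⇝ X) (b : Bool) → η b ⊑ both →
                  k b ⊑ μ (fmap k both)
    extend-both k b le =
      ≤-resp (♯-pre k (const b)) (λ _ → refl) (·-mono {g = k} le ≤-refl)

    -- Collapsing `Bool` to a point turns `step` into `𝟙`, whose saturation is again `𝟙`. This bound
    -- makes `∨` a least upper bound.
    total-both : fmap (const tt) both ⊑ η tt
    total-both = ≤-resp (λ _ → ♯-post (const tt) (step *) true) (λ _ → refl)
                   (≤⇒⊑ {f = (const tt ♯) · (step *)} {g = 𝟙 ∘ const tt} !*≤! true)
      where
      !*≤! : ((const tt ♯) · (step *)) ≤ (𝟙 ∘ const tt)
      !*≤! = ≤-trans
        (sat-5≤ (const tt) step 𝟙
          (≐⇒≤ λ b → trans (♯-pre (const tt ♯) (const false) b)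
                           (sym (♯-pre 𝟙 (const tt) b))))
        (≤-resp (λ _ → refl) (♯-pre 𝟙 (const tt)) (·-mono ≤-refl 𝟙*≤𝟙))

  ∨-upperˡ : {X : Set} (s t : T X) → s ⊑ s ∨ t
  ∨-upperˡ s t = extend-both (if_then s else t) true (≤⇒⊑ (sat-1 step) true)

  ∨-upperʳ : {X : Set} (s t : T X) → t ⊑ s ∨ t
  ∨-upperʳ s t = extend-both (if_then s else t) false (≤⇒⊑ (sat-2 step) true)

  ∨-least : {X : Set} {s t u : T X} → s ⊑ u → t ⊑ u → s ∨ t ⊑ u
  ∨-least {s = s} {t} {u} s⊑u t⊑u = ≤-trans
    (·-mono {f = const both} ≤-refl branches)
    -- Once both branches are `u`, the choice factors through the point, where `total-both` applies.
    (≤-resp (λ _ → cong μ (fmap-fuse (const u) (const tt) (const u) (λ _ → refl) both))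
            (♯-pre (const u) id)
            (·-mono {g = const u} total-both ≤-refl))
    where
    branches : (if_then s else t) ≤ const u
    -- `Bool` is read as a coproduct of two points, so that cotupling compares the branches
    -- separately.
    branches = ∘-monoˡ {Y = Σ Bool (const ⊤)} (_, tt)
      (cotupling (λ b _ → if b then s else t) (λ _ _ → u)
        λ { true → s⊑u ; false → t⊑u })

  ∨-comm : {X : Set} (s t : T X) → s ∨ t ≡ t ∨ s
  ∨-comm s t = ⊑-antisym (∨-least (∨-upperʳ t s) (∨-upperˡ t s))
                         (∨-least (∨-upperʳ s t) (∨-upperˡ s t))

  ⊑⇒∨≡ : {X : Set} {s t : T X} → s ⊑ t → s ∨ t ≡ t
  ⊑⇒∨≡ {s = s} {t} le = ⊑-antisym (∨-least le ≤-refl) (∨-upperʳ s t)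

  ∨-absorb-middle : {X : Set} {s t u : T X} → u ⊑ s → (t ∨ u) ∨ s ≡ t ∨ s
  ∨-absorb-middle {s = s} {t} {u} le = ⊑-antisym
    (∨-least (∨-least (∨-upperˡ t s) (≤-trans le (∨-upperʳ t s))) (∨-upperʳ t s))
    (∨-least (≤-trans (∨-upperˡ t u) (∨-upperˡ _ s)) (∨-upperʳ _ s))

-- Couplings over an equivalence relation.

module Couplings (S : OrderedSaturationMonad) (cotupling : CotuplingMonotonic S)
                 (pullbacks : WeaklyLaxPreservesPullbacks S) where
  open OrderedSaturationMonad S
  open SaturationProperties S
  open Joins S cotupling

  -- The Barr lifting of `Q` to `T X`, with its witness.
  Coupling : {X : Set} → (X → X → Set) → T X → T X → Set
  Coupling Q s t = Σ (T (Graph Q)) λ q → (fmap src q ≡ s) × (fmap tgt q ≡ t)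

  module _ {X : Set} {Q : X → X → Set} (equiv : IsEquivalence Q) where
    private module Q = IsEquivalence equiv

    coupling-refl : (s : T X) → Coupling Q s s
    coupling-refl s = fmap diagonal s , marginal src (λ _ → refl) , marginal tgt (λ _ → refl)
      where
      diagonal : X → Graph Q
      diagonal x = (x , x) , Q.refl

      marginal : (π : Graph Q → X) → π ∘ diagonal ≐ id → fmap π (fmap diagonal s) ≡ s
      marginal π e = trans (fmap-fuse π diagonal id e s) (fmap-id s)

    coupling-sym : {s t : T X} → Coupling Q s t → Coupling Q t s
    coupling-sym (q , q-src , q-tgt) =
      fmap swap q ,
      trans (fmap-fuse src swap tgt (λ _ → refl) q) q-tgt ,
      trans (fmap-fuse tgt swap src (λ _ → refl) q) q-src
      where
      swap : Graph Q → Graph Q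
      swap ((x , y) , r) = (y , x) , Q.sym r

    coupling-trans : {s t u : T X} → Coupling Q s t → Coupling Q t u → Coupling Q s u
    coupling-trans (q , q-src , q-tgt) (q' , q'-src , q'-tgt)
      with proj₁ (pullbacks {A = Graph Q} {B = Graph Q} tgt src) q q' (trans q-tgt (sym q'-src))
    ... | v , v₁ , v₂ =
      fmap compose v ,
      trans (fmap-fuse src compose (src ∘ pb₁ S) (λ _ → refl) v)
        (trans (fmap-∘ src (pb₁ S) v) (trans (cong (fmap src) v₁) q-src)) ,
      trans (fmap-fuse tgt compose (tgt ∘ pb₂ S) (λ _ → refl) v)
        (trans (fmap-∘ tgt (pb₂ S) v) (trans (cong (fmap tgt) v₂) q'-tgt))
      where
      compose : Pullback S {A = Graph Q} {B = Graph Q} tgt src → Graph Q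
      compose ((((x , _) , r) , ((_ , z) , r')) , e) =
        (x , z) , Q.trans r (Q.trans (Q.reflexive e) r')

    coupling-∨ : {s s' t t' : T X} → Coupling Q s t → Coupling Q s' t' →
                 Coupling Q (s ∨ s') (t ∨ t')
    coupling-∨ (q , q-src , q-tgt) (q' , q'-src , q'-tgt) =
      q ∨ q' ,
      trans (fmap-∨ src q q') (cong₂ _∨_ q-src q'-src) ,
      trans (fmap-∨ tgt q q') (cong₂ _∨_ q-tgt q'-tgt)

    -- The equation t ∨ src p = src p lifts along src.  The part lying over t
    -- is the coupling sought.  The part lying over src p cannot be discarded, as
    -- T need not have a bottom; it is kept and sent along tgt instead, which
    -- adds only tgt p to the right marginal.
    coupling-trim : {t : T X} (p : T (Graph Q)) → t ⊑ fmap src p →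
                    Coupling Q (fmap tgt p) (t ∨ fmap tgt p)
    coupling-trim {t} p t⊑p
      with proj₁ (pullbacks {A = X ⊎ Graph Q} {B = Graph Q} [ id , src ] src)
                 (fmap inj₁ t ∨ fmap inj₂ p) p lifted
      where
      lifted : fmap [ id , src ] (fmap inj₁ t ∨ fmap inj₂ p) ≡ fmap src p
      lifted = trans (fmap-∨ [ id , src ] _ _)
        (trans (cong₂ _∨_ (trans (fmap-fuse [ id , src ] inj₁ id (λ _ → refl) t) (fmap-id t))
                          (fmap-fuse [ id , src ] inj₂ src (λ _ → refl) p))
               (⊑⇒∨≡ t⊑p))
    ... | v , v₁ , v₂ =
      fmap relate v ,
      trans (fmap-fuse src relate (tgt ∘ pb₂ S) relate-src v)
        (trans (fmap-∘ tgt (pb₂ S) v) (cong (fmap tgt) v₂)) ,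
      trans (fmap-fuse tgt relate ([ id , tgt ] ∘ pb₁ S) relate-tgt v)
        (trans (fmap-∘ [ id , tgt ] (pb₁ S) v)
          (trans (cong (fmap [ id , tgt ]) v₁)
            (trans (fmap-∨ [ id , tgt ] _ _)
              (cong₂ _∨_ (trans (fmap-fuse [ id , tgt ] inj₁ id (λ _ → refl) t) (fmap-id t))
                         (fmap-fuse [ id , tgt ] inj₂ tgt (λ _ → refl) p)))))
      where
      P : Set
      P = Pullback S {A = X ⊎ Graph Q} {B = Graph Q} [ id , src ] src

      relate : P → Graph Q
      relate ((inj₁ y , ((_ , x) , r)) , e) = (x , y) , Q.sym (Q.trans (Q.reflexive e) r)
      relate ((inj₂ ((_ , x') , r') , ((_ , x) , r)) , e) =
        (x , x') , Q.sym (Q.trans (Q.sym r') (Q.trans (Q.reflexive e) r))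

      relate-src : src ∘ relate ≐ tgt ∘ pb₂ S
      relate-src ((inj₁ _ , _) , _) = refl
      relate-src ((inj₂ _ , _) , _) = refl

      relate-tgt : tgt ∘ relate ≐ [ id , tgt ] ∘ pb₁ S
      relate-tgt ((inj₁ _ , _) , _) = refl
      relate-tgt ((inj₂ _ , _) , _) = refl

    LaxCoupling : T X → T X → Set
    LaxCoupling s t = Σ (T (Graph Q)) λ p → (s ⊑ fmap src p) × (fmap tgt p ⊑ t)

    -- Joining the trimmed coupling with the diagonal one on `s` lets `s` absorb the surplus
    -- `fmap tgt p` in both marginals.
    lax⇒coupling-∨ : {s t : T X} → LaxCoupling t s → Coupling Q s (t ∨ s)
    lax⇒coupling-∨ {s} {t} (p , t⊑p , p⊑s)
      with coupling-∨ (coupling-trim p t⊑p) (coupling-refl s)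
    ... | q , q-src , q-tgt =
      q , trans q-src (⊑⇒∨≡ p⊑s) , trans q-tgt (∨-absorb-middle p⊑s)

    -- Both elements are coupled with the same join, up to commutativity, and the couplings compose
    -- through it.
    lax-antisym : {s t : T X} → LaxCoupling s t → LaxCoupling t s → Coupling Q s t
    lax-antisym {s} {t} st ts with lax⇒coupling-∨ ts | lax⇒coupling-∨ st
    ... | c | (q , q-src , q-tgt) =
      coupling-trans c (coupling-sym (q , q-src , trans q-tgt (∨-comm s t)))

  -- Finality and the two implications.

  module _ (F : FinalCoalgebra S) where
    open FinalCoalgebra F

    -- The couplings form a coalgebra `δ` on the graph of `Q` whose two projections are
    -- homomorphisms to `β`; finality equates their composites with `beh β`.
    bisimilar⇒beh≡ : {X : Set} (β : X → T X) (Q : X → X → Set) →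
                     (∀ {x y} → Q x y → Coupling Q (β x) (β y)) →
                     ∀ {x y} → Q x y → beh β x ≡ beh β y
    bisimilar⇒beh≡ {X} β Q coupled {x} {y} r =
      trans (beh-unique δ (beh β ∘ src) (hom src λ w → proj₁ (proj₂ (coupled (proj₂ w)))) w₀)
        (sym (beh-unique δ (beh β ∘ tgt) (hom tgt λ w → proj₂ (proj₂ (coupled (proj₂ w)))) w₀))
      where
      w₀ : Graph Q
      w₀ = (x , y) , r

      δ : Graph Q → T (Graph Q)
      δ w = proj₁ (coupled (proj₂ w))

      hom : (π : Graph Q → X) → IsCoalgHom δ β π → IsCoalgHom δ ζ (beh β ∘ π)
      hom π π-hom w = trans (fmap-∘ (beh β) π (δ w))
        (trans (cong (fmap (beh β)) (π-hom w)) (beh-hom β (π w)))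

    beh-*-∘ : {X : Set} (α : X → T X) → beh (ζ *) ∘ beh α ≐ beh (α *)
    beh-*-∘ α = beh-unique (α *) (beh (ζ *) ∘ beh α) λ x →
      trans (fmap-∘ (beh (ζ *)) (beh α) ((α *) x))
        (trans (cong (fmap (beh (ζ *))) (*-preserves-hom (beh-hom α) x))
               (beh-hom (ζ *) (beh α x)))

    module _ {X : Set} (α : X → T X) where

      weakBisimulation⇒beh*≡ : (R : X → X → Set) → IsWeakBisimulation S α R →
                               ∀ {x y} → R x y → beh (α *) x ≡ beh (α *) y
      weakBisimulation⇒beh*≡ R isWB r =
        -- As `R` is symmetric, `Star R` is its equivalence closure.
        bisimilar⇒beh≡ (α *) (Star R) coupled (return r)
        where
        open IsWeakBisimulation isWB

        equiv : IsEquivalence (Star R)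
        equiv = record { refl = ε ; sym = reverse symmetric ; trans = _◅◅_ }

        γ-src : ((α *) ∘ src) ≤ (fmap src ∘ (γ *))
        γ-src = ≤-resp (♯-pre (α *) src) (♯-post src (γ *)) (sat-5≥ src γ α cond₁)

        γ-tgt : (fmap tgt ∘ (γ *)) ≤ ((α *) ∘ tgt)
        γ-tgt = ≤-trans
          (≤-resp (♯-post tgt (γ *)) (♯-pre ((α *) *) tgt) (sat-5≤ tgt γ (α *) cond₂))
          (∘-monoˡ tgt (**≤* α))

        embed : Graph R → Graph (Star R)
        embed (xy , r) = xy , return r

        lax : ∀ {x y} → R x y → LaxCoupling equiv ((α *) x) ((α *) y)
        lax r = fmap embed ((γ *) (_ , r)) ,
          ≤-resp (λ _ → refl) (λ _ → sym (fmap-fuse src embed src (λ _ → refl) _)) (≤⇒⊑ γ-src (_ , r)) ,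
          ≤-resp (λ _ → sym (fmap-fuse tgt embed tgt (λ _ → refl) _)) (λ _ → refl) (≤⇒⊑ γ-tgt (_ , r))

        coupled : ∀ {x y} → Star R x y → Coupling (Star R) ((α *) x) ((α *) y)
        coupled ε       = coupling-refl equiv _
        coupled (r ◅ p) = coupling-trans equiv
          -- `γ *` gives a lax coupling in one direction; symmetry of `R` supplies the other.
          (lax-antisym equiv (lax r) (lax (symmetric r))) (coupled p)

      beh*-kernel-isWeakBisimulation :
        IsWeakBisimulation S α (λ x y → beh (α *) x ≡ beh (α *) y)
      beh*-kernel-isWeakBisimulation
        -- The graph of the kernel is by definition the pullback of `beh (α *)` with itself, so `ξ`
        -- is a coalgebra on it. After weakening `α` to `α *`, both sides equal `ζ` at the common
        -- behaviour.
        with proj₂ (pullbacks (beh (α *)) (beh (α *))) (α ∘ src) ((α *) ∘ tgt)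
               (≤-trans (fmap-mono (beh (α *)) (∘-monoˡ src (sat-2 α)))
                 (≐⇒≤ λ w → trans (beh-hom (α *) (src w))
                   (trans (cong ζ (proj₂ w)) (sym (beh-hom (α *) (tgt w))))))
      ... | ξ , α≤ξ , ξ≤α* = record
        { symmetric = sym
        ; γ         = ξ
        ; cond₁     = ≤-resp (sym ∘ ♯-pre α src) (sym ∘ ♯-post src ξ) α≤ξ
        ; cond₂     = ≤-resp (sym ∘ ♯-post tgt ξ) (sym ∘ ♯-pre (α *) tgt) ξ≤α*
        }

theorem6p10 : (S : OrderedSaturationMonad) →
    CotuplingMonotonic S → WeaklyLaxPreservesPullbacks S →
    (F : FinalCoalgebra S) →
    let open OrderedSaturationMonad S
        open FinalCoalgebra F
    in {X : Set} (α : X → T X) (x y : X) →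
       (WeaklyBisimilar S α x y → beh (ζ *) (beh α x) ≡ beh (ζ *) (beh α y))
       × (beh (ζ *) (beh α x) ≡ beh (ζ *) (beh α y) → WeaklyBisimilar S α x y)
theorem6p10 S cotupling pullbacks F α x y =
  (λ (R , isWB , r) → trans (beh-*-∘ F α x)
    (trans (weakBisimulation⇒beh*≡ F α R isWB r) (sym (beh-*-∘ F α y)))) ,
  (λ e → _ , beh*-kernel-isWeakBisimulation F α ,
    trans (sym (beh-*-∘ F α x)) (trans e (beh-*-∘ F α y)))
  where open Couplings S cotupling pullbacks
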